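{- Let $\varphi,\psi$ be modal formulas and let $\chi=\varphi\leftrightarrow\psi$. The pair $(\varphi,\psi)$ is $k$-indistinguishable if and only if $\chi$ has minimal countermodel size exactly $k+1$ in $\mathsf{K}$ (the class of all finite frames). In that case a separating $(k+1)$-world model (a model on $k+1$ worlds in which $\chi$ is false at some world $w$) is a conclusive witness that $\chi$ is not valid on $\mathsf{K}$, it yields a valid certificate for $\chi$ whose validity can be checked in $O(|\chi|(k+1))$ by the recursive definition of satisfaction, and it exhibits a world at which $\varphi$ and $\psi$ disagree.
   Context: Modal formulas over variables $p_0,p_1,\dots$ are generated by $\varphi ::= \top\mid\bot\mid p_i\mid\neg\varphi\mid\varphi\wedge\varphi\mid\varphi\vee\varphi\mid\varphi\rightarrow\varphi\mid\Box\varphi\mid\Diamond\varphi$; $|\varphi|$ is the node count; $\varphi\leftrightarrow\psi$ is the biconditional. A frame is $\mathcal{F}=(W,R)$ with $W$ finite and $R\subseteq W^2$; a model adds a valuation $V$ assigning to each variable a subset of $W$. Satisfaction is standard Kripke satisfaction ($\Box$: all $R$-successors; $\Diamond$: some $R$-successor). $\mathcal{F}\models\varphi$ means $\varphi$ is true at every world under every valuation. A countermodel to $\varphi$ is $(\mathcal{F},V,w)$ with $\varphi$ false at $w$ in $(\mathcal{F},V)$; its size is $|W|$; the minimal countermodel size in $\mathsf{K}$ is the least size of a countermodel over all frames. Two formulas $\varphi,\psi$ are $k$-indistinguishable if $\mathcal{F}\models\varphi\leftrightarrow\psi$ for every frame $\mathcal{F}$ with $|W|\le k$ but not for some frame with $|W|=k+1$.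 The least such failing size $k+1$ is their separation size. A certificate is a tuple $(\chi,n,\mathrm{succ},V,w,\mathcal{C})$ recording a formula, a world count $n$, a frame on $\{0,\dots,n-1\}$ given by successor masks $\mathrm{succ}[u]=\sum_{v:R(u,v)}2^v$, a valuation, a world and a frame class; it is valid if the frame lies in $\mathcal{C}$ and $\chi$ is false at $w$ in the recorded model. Here $\mathcal{C}=\mathsf{K}$ and $n=k+1$. Costs are counted in word operations, a set of worlds being one word. -}

module Defs where

open import Data.Bool.Base using (Bool; true; false; not; if_then_else_; T; _∧_; _∨_)
open import Data.Empty using (⊥)
open import Data.Fin.Base using (Fin; toℕ)
import Data.Fin.Properties as Fin
open import Data.List.Base using (List; []; _∷_; allFin)
open import Data.Nat.Base using (ℕ; suc; _+_; _*_; _^_; _/_; _%_; _≤_; _≡ᵇ_)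
open import Data.Nat.Properties using (m^n≢0)
open import Data.Product.Base using (∃-syntax; Σ-syntax; _×_)
open import Data.Sum.Base using (_⊎_)
open import Data.Unit.Base using (⊤; tt)
import Data.Vec.Base as Vec
open import Function.Base using (const)
open import Function.Bundles using (_↔_; Inverse)
open import Function.Construct.Identity using (↔-id)
open import Relation.Binary.PropositionalEquality using (_≡_)
open import Relation.Nullary using (¬_; does)

infix  9 ¬ᶠ_ □_ ◇_
infixr 7 _∧ᶠ_
infixr 6 _∨ᶠ_
infixr 5 _⇒ᶠ_
infix  4 _⇔ᶠ_

data Formula : Set where
  ⊤ᶠ ⊥ᶠ          : Formula
  var            : ℕ → Formula
  ¬ᶠ_            : Formula → Formula
  _∧ᶠ_ _∨ᶠ_ _⇒ᶠ_ : Formula → Formula → Formula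
  □_ ◇_          : Formula → Formula

_⇔ᶠ_ : Formula → Formula → Formula
φ ⇔ᶠ ψ = (φ ⇒ᶠ ψ) ∧ᶠ (ψ ⇒ᶠ φ)

nodes : Formula → ℕ
nodes ⊤ᶠ       = 1
nodes ⊥ᶠ       = 1
nodes (var i)  = 1
nodes (¬ᶠ φ)   = suc (nodes φ)
nodes (φ ∧ᶠ ψ) = suc (nodes φ + nodes ψ)
nodes (φ ∨ᶠ ψ) = suc (nodes φ + nodes ψ)
nodes (φ ⇒ᶠ ψ) = suc (nodes φ + nodes ψ)
nodes (□ φ)    = suc (nodes φ)
nodes (◇ φ)    = suc (nodes φ)

-- Subsets of W and of W² are Bool-valued characteristic functions: W is
-- finite, and classically these are all of its subsets.

record Frame : Set₁ where
  field
    World : Set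
    size  : ℕ
    enum  : World ↔ Fin size
    R     : World → World → Bool

Valuation : Frame → Set
Valuation F = ℕ → Frame.World F → Bool

record Model : Set₁ where
  constructor ⟨_,_⟩
  field
    frame : Frame
    V     : Valuation frame
  open Frame frame public

infix 3 _at_⊨_

_at_⊨_ : (M : Model) → Model.World M → Formula → Set
M at w ⊨ ⊤ᶠ       = ⊤
M at w ⊨ ⊥ᶠ       = ⊥
M at w ⊨ var i    = T (Model.V M i w)
M at w ⊨ ¬ᶠ φ     = ¬ (M at w ⊨ φ)
M at w ⊨ φ ∧ᶠ ψ   = (M at w ⊨ φ) × (M at w ⊨ ψ)
M at w ⊨ φ ∨ᶠ ψ   = (M at w ⊨ φ) ⊎ (M at w ⊨ ψ)
M at w ⊨ φ ⇒ᶠ ψ   = M at w ⊨ φ → M at w ⊨ ψ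
M at w ⊨ □ φ      = ∀ v → T (Model.R M w v) → M at v ⊨ φ
M at w ⊨ ◇ φ      = ∃[ v ] T (Model.R M w v) × (M at v ⊨ φ)

infix 3 _⊨ᶠ_

_⊨ᶠ_ : Frame → Formula → Set
F ⊨ᶠ φ = (V : Valuation F) (w : Frame.World F) → ⟨ F , V ⟩ at w ⊨ φ

FrameClass : Set₁
FrameClass = Frame → Set

K : FrameClass
K = const ⊤

ValidOn : FrameClass → Formula → Set₁
ValidOn 𝒞 φ = (F : Frame) → 𝒞 F → F ⊨ᶠ φ

record Countermodel (𝒞 : FrameClass) (χ : Formula) : Set₁ where
  field
    model     : Model
    world     : Model.World model
    inClass   : 𝒞 (Model.frame model)
    falsified : ¬ (model at world ⊨ χ)
  open Model model public using (size)

MinimalCountermodelSize : FrameClass → Formula → ℕ → Set₁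
MinimalCountermodelSize 𝒞 χ m =
  (Σ[ c ∈ Countermodel 𝒞 χ ] Countermodel.size c ≡ m) ×
  ((c : Countermodel 𝒞 χ) → m ≤ Countermodel.size c)

Indistinguishable : ℕ → Formula → Formula → Set₁
Indistinguishable k φ ψ =
  ((F : Frame) → Frame.size F ≤ k → F ⊨ᶠ (φ ⇔ᶠ ψ)) ×
  (Σ[ F ∈ Frame ] Frame.size F ≡ suc k × ¬ (F ⊨ᶠ (φ ⇔ᶠ ψ)))

Disagree : (M : Model) → Model.World M → Formula → Formula → Set
Disagree M w φ ψ =
  ((M at w ⊨ φ) × ¬ (M at w ⊨ ψ)) ⊎ (¬ (M at w ⊨ φ) × (M at w ⊨ ψ))

Word : Set
Word = ℕ

bit : Word → ℕ → Bool
bit x i = (_/_ x (2 ^ i) {{m^n≢0 2 i}}) % 2 ≡ᵇ 1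

mask : ∀ {n} → (Fin n → Bool) → Word
mask p = Vec.sum (Vec.tabulate λ v → if p v then 2 ^ toℕ v else 0)

_∈ʷ_ : ∀ {n} → Fin n → Word → Bool
v ∈ʷ x = bit x (toℕ v)

IsMask : ℕ → Word → Set
IsMask n x = x ≡ mask {n} (_∈ʷ x)

record Certificate : Set₁ where
  field
    formula   : Formula
    n         : ℕ
    succ      : Fin n → Word
    succ-mask : ∀ u → IsMask n (succ u)
    V         : ℕ → Word
    V-mask    : ∀ i → IsMask n (V i)
    w         : Fin n
    class     : FrameClass

  recordedFrame : Frame
  recordedFrame = record
    { World = Fin n
    ; size  = n
    ; enum  = ↔-id (Fin n)
    ; R     = λ u v → v ∈ʷ succ u
    }

  recordedModel : Model
  recordedModel = ⟨ recordedFrame , (λ i v → v ∈ʷ V i) ⟩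

ValidCertificate : Certificate → Set
ValidCertificate c = class recordedFrame × ¬ (recordedModel at w ⊨ formula)
  where open Certificate c

-- The certificate's model is M with its worlds renamed to 0, …, n-1, and its
-- world is the new name of w.
record Records (c : Certificate) (M : Model) (w : Model.World M) : Set where
  private
    module C = Certificate c
    module M = Model M
  field
    relabel : M.World ↔ Fin C.n
  open Inverse relabel using (to; from)
  field
    succ-records  : ∀ u → C.succ u ≡ mask (λ v → M.R (from u) (from v))
    V-records     : ∀ i → C.V i ≡ mask (λ v → M.V i (from v))
    world-records : to w ≡ C.w

-- A computation together with the number of word operations it performs.
record Counted (A : Set) : Set where
  constructor counted
  field
    value : A
    cost  : ℕ
open Counted public

return : ∀ {A} → A → Counted A
return a = counted a 0

infixl 1 _>>=_ _>>_

_>>=_ : ∀ {A B} → Counted A → (A → Counted B) → Counted B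
m >>= f = counted (value (f (value m))) (cost m + cost (f (value m)))

_>>_ : ∀ {A B} → Counted A → Counted B → Counted B
m >> m′ = m >>= const m′

op : ∀ {A} → A → Counted A
op a = counted a 1

-- The word operations on sets of worlds, each of cost one.  Only these and
-- `tick` may do work in the checker below.
module WordOps (n : ℕ) where

  tick : Counted ⊤
  tick = op tt

  fullʷ emptyʷ : Counted Word
  fullʷ  = op (mask {n} (const true))
  emptyʷ = op 0

  complementʷ : Word → Counted Word
  complementʷ x = op (mask {n} λ v → not (v ∈ʷ x))

  intersectʷ unionʷ : Word → Word → Counted Word
  intersectʷ x y = op (mask {n} λ v → (v ∈ʷ x) ∧ (v ∈ʷ y))
  unionʷ     x y = op (mask {n} λ v → (v ∈ʷ x) ∨ (v ∈ʷ y))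

  insertʷ : Fin n → Word → Counted Word
  insertʷ u x = op (mask {n} λ v → does (v Fin.≟ u) ∨ (v ∈ʷ x))

  isEmptyʷ : Word → Counted Bool
  isEmptyʷ x = op (x ≡ᵇ 0)

  memberʷ : Fin n → Word → Counted Bool
  memberʷ v x = op (v ∈ʷ x)

  notᵇ : Bool → Counted Bool
  notᵇ b = op (not b)

  load : ∀ {I : Set} → (I → Word) → I → Counted Word
  load table i = op (table i)

  -- The set of listed worlds that pass the test.
  collect : (Fin n → Counted Bool) → List (Fin n) → Counted Word
  collect test []       = emptyʷ
  collect test (u ∷ us) = do
    tick
    x ← collect test us
    b ← test u
    if b then insertʷ u x else return x

-- The recursive definition of satisfaction, computing the truth set of each
-- subformula as one word; the tick in each clause pays for visiting the node.
module _ {n : ℕ} (succ : Fin n → Word) (V : ℕ → Word) where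
  open WordOps n

  truthSet : Formula → Counted Word
  truthSet ⊤ᶠ = do
    tick
    fullʷ
  truthSet ⊥ᶠ = do
    tick
    emptyʷ
  truthSet (var i) = do
    tick
    load V i
  truthSet (¬ᶠ φ) = do
    tick
    x ← truthSet φ
    complementʷ x
  truthSet (φ ∧ᶠ ψ) = do
    tick
    x ← truthSet φ
    y ← truthSet ψ
    intersectʷ x y
  truthSet (φ ∨ᶠ ψ) = do
    tick
    x ← truthSet φ
    y ← truthSet ψ
    unionʷ x y
  truthSet (φ ⇒ᶠ ψ) = do
    tick
    x ← truthSet φ
    y ← truthSet ψ
    x̄ ← complementʷ x
    unionʷ x̄ y
  truthSet (□ φ) = do
    tick
    x ← truthSet φ
    x̄ ← complementʷ x
    collect (λ u → do
        s ← load succ u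
        bad ← intersectʷ s x̄
        isEmptyʷ bad)
      (allFin n)
  truthSet (◇ φ) = do
    tick
    x ← truthSet φ
    collect (λ u → do
        s ← load succ u
        good ← intersectʷ s x
        e ← isEmptyʷ good
        notᵇ e)
      (allFin n)

-- Every frame lies in K, so for certificates of class K the only thing to
-- check is that the formula is false at the recorded world.
checkK : Certificate → Counted Bool
checkK c = do
  x ← truthSet succ V formula
  b ← memberʷ w x
  notᵇ b
  where
  open Certificate c
  open WordOps n

{-# OPTIONS --safe #-}

-- Constructively, "F ⊭ χ" has to produce a valuation and a world.  The checker
-- decides satisfaction in recorded models, hence, by transport along an
-- enumeration of the worlds, in all models; and only the finitely many
-- valuations of the variables of χ have to be searched.

module Submission where

open import Defs
open import Data.Bool.Base using (Bool; true; false; not; if_then_else_; T; _∧_; _∨_)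
open import Data.Bool.Properties using (∧-zeroʳ; ∧-identityʳ; ∨-idem)
open import Data.Empty using (⊥-elim)
open import Data.Fin.Base using (Fin; zero; suc; toℕ; fromℕ<; combine; remQuot)
import Data.Fin.Properties as Fin
open import Data.Fin.Subset using (Subset)
open import Data.Fin.Subset.Properties using (anySubset?)
open import Data.List.Base using ([]; _∷_; allFin; length)
open import Data.List.Membership.Propositional using (_∈_)
open import Data.List.Membership.Propositional.Properties using (∈-allFin)
open import Data.List.Properties using (length-tabulate)
open import Data.List.Relation.Unary.Any using (here; there)
open import Data.Nat.Base
  using (ℕ; zero; suc; _+_; _*_; _^_; _/_; _%_; _⊔_; _≤_; _<_; _≡ᵇ_; z≤n; NonZero)
open import Data.Nat.Divisibility using (n∣m*n)
open import Data.Nat.DivMod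
  using (0/n≡0; n/1≡n; m*n/n≡m; m/n/o≡m/[n*o]; [m+kn]%n≡m%n; +-distrib-/-∣ʳ)
open import Data.Nat.Properties
open import Data.Nat.Tactic.RingSolver using (solve-∀)
open import Data.Product.Base as Product using (Σ-syntax; ∃-syntax; ∃; _×_; _,_; proj₂; uncurry)
open import Data.Product.Function.NonDependent.Propositional using (_×-⇔_)
open import Data.Sum.Base using (inj₁; inj₂)
open import Data.Sum.Function.Propositional using (_⊎-⇔_)
open import Data.Unit.Base using (tt)
import Data.Vec.Base as Vec
import Data.Vec.Properties as Vec
open import Function.Base using (_∘_; const; id)
open import Function.Bundles using (_⇔_; _↔_; mk⇔; Equivalence; Inverse)
open import Function.Construct.Identity using (⇔-id; ↔-id)
open import Function.Related.TypeIsomorphisms using (→-cong-⇔; ¬-cong-⇔)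
open import Relation.Binary.PropositionalEquality
  using (_≡_; refl; sym; trans; cong; cong₂; subst; module ≡-Reasoning)
open import Relation.Nullary using (¬_; Dec; yes; no; does; contradiction; _because_)
open import Relation.Nullary.Decidable
  using (T?; map; map′; ¬?; dec-true; decidable-stable; proof)
open import Relation.Nullary.Reflects
  using (Reflects; ofʸ; ofⁿ; fromEquivalence; T-reflects; ¬-reflects;
         _×-reflects_; _⊎-reflects_; _→-reflects_)
open import Relation.Unary using (Decidable)

-- Words as sets of worlds

sum-tabulate-*ʳ : ∀ {n} (f : Fin n → ℕ) k →
  Vec.sum (Vec.tabulate λ v → f v * k) ≡ Vec.sum (Vec.tabulate f) * k
sum-tabulate-*ʳ {zero}  f k = refl
sum-tabulate-*ʳ {suc n} f k = trans
  (cong (f zero * k +_) (sum-tabulate-*ʳ (f ∘ suc) k))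
  (sym (*-distribʳ-+ k (f zero) _))

mask-cong : ∀ {n} {p q : Fin n → Bool} → (∀ v → p v ≡ q v) → mask p ≡ mask q
mask-cong p≗q = cong Vec.sum
  (Vec.tabulate-cong λ v → cong (λ b → if b then 2 ^ toℕ v else 0) (p≗q v))

mask-∅ : ∀ n → mask {n} (const false) ≡ 0
mask-∅ zero    = refl
mask-∅ (suc n) = mask-∅ n

-- Horner form: the lowest binary digit is split off and the rest is doubled. `bit-zero` and
-- `bit-suc` read digits of numbers in exactly this shape.
mask-suc : ∀ {n} (p : Fin (suc n) → Bool) →
  mask p ≡ (if p zero then 1 else 0) + mask (p ∘ suc) * 2
mask-suc p = cong ((if p zero then 1 else 0) +_) (trans
  (cong Vec.sum (Vec.tabulate-cong λ v → shift (p (suc v)) (2 ^ toℕ v)))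
  (sum-tabulate-*ʳ (λ v → if p (suc v) then 2 ^ toℕ v else 0) 2))
  where
  shift : ∀ b x → (if b then 2 * x else 0) ≡ (if b then x else 0) * 2
  shift true  x = *-comm 2 x
  shift false x = refl

bit-zero : ∀ b m → bit ((if b then 1 else 0) + m * 2) 0 ≡ b
bit-zero b m = begin
  bit (d + m * 2) 0            ≡⟨ cong (λ q → q % 2 ≡ᵇ 1) (n/1≡n (d + m * 2)) ⟩
  ((d + m * 2) % 2 ≡ᵇ 1)       ≡⟨ cong (_≡ᵇ 1) ([m+kn]%n≡m%n d m 2) ⟩
  (d % 2 ≡ᵇ 1)                 ≡⟨ digit b ⟩
  b                            ∎
  where
  open ≡-Reasoning
  d = if b then 1 else 0
  digit : ∀ b → ((if b then 1 else 0) % 2 ≡ᵇ 1) ≡ b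
  digit true  = refl
  digit false = refl

bit-suc : ∀ b m i → bit ((if b then 1 else 0) + m * 2) (suc i) ≡ bit m i
bit-suc b m i = cong (λ q → q % 2 ≡ᵇ 1) (begin
  (d + m * 2) / (2 * 2 ^ i)    ≡⟨ m/n/o≡m/[n*o] (d + m * 2) 2 (2 ^ i) ⟨
  (d + m * 2) / 2 / 2 ^ i      ≡⟨ cong (_/ 2 ^ i) half ⟩
  m / 2 ^ i                    ∎)
  where
  open ≡-Reasoning
  instance _ = m^n≢0 2 i
  instance _ = m^n≢0 2 (suc i)
  d = if b then 1 else 0
  d/2 : ∀ b → (if b then 1 else 0) / 2 ≡ 0
  d/2 true  = refl
  d/2 false = refl
  half : (d + m * 2) / 2 ≡ m
  -- Since 2 divides `m * 2`, the quotient splits, and the digit `d`, being below 2, contributes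
  -- nothing.
  half = trans (+-distrib-/-∣ʳ d (n∣m*n m)) (cong₂ _+_ (d/2 b) (m*n/n≡m m 2))

-- Induction on the position, stripping one binary digit per step. Through this fact each word
-- operation defined by `mask` acts as its Boolean operation at every world.
∈ʷ-mask : ∀ {n} (p : Fin n → Bool) v → v ∈ʷ mask p ≡ p v
∈ʷ-mask p zero    = trans (cong (λ x → bit x 0) (mask-suc p)) (bit-zero (p zero) (mask (p ∘ suc)))
∈ʷ-mask p (suc v) = trans (cong (λ x → bit x (suc (toℕ v))) (mask-suc p))
  (trans (bit-suc (p zero) (mask (p ∘ suc)) (toℕ v)) (∈ʷ-mask (p ∘ suc) v))

mask-isMask : ∀ {n} (p : Fin n → Bool) → IsMask n (mask p)
mask-isMask p = mask-cong (sym ∘ ∈ʷ-mask p)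

∈ʷ-∅ : ∀ {n} (v : Fin n) → v ∈ʷ 0 ≡ false
∈ʷ-∅ v = cong (λ q → q % 2 ≡ᵇ 1) (0/n≡0 (2 ^ toℕ v) {{m^n≢0 2 (toℕ v)}})

reflects-⇔ : ∀ {A B : Set} {b} → A ⇔ B → Reflects A b → Reflects B b
reflects-⇔ A⇔B r = proof (map A⇔B (_ because r))

reflects⇒T-⇔ : ∀ {A : Set} {b} → Reflects A b → T b ⇔ A
reflects⇒T-⇔ (ofʸ  a) = mk⇔ (const a) _
reflects⇒T-⇔ (ofⁿ ¬a) = mk⇔ (λ ()) ¬a

mask-reflects : ∀ {n} {P : Set} (p : Fin n → Bool) v →
  Reflects P (p v) → Reflects P (v ∈ʷ mask p)
mask-reflects p v = subst (Reflects _) (sym (∈ʷ-mask p v))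

-- Serves both modalities: box tests that the set of bad successors is empty, diamond that the set
-- of good ones is not.
mask-empty : ∀ {n} (p : Fin n → Bool) → Reflects (∀ v → ¬ T (p v)) (mask p ≡ᵇ 0)
mask-empty {n} p = fromEquivalence empty⇒ ⇒empty
  where
  empty⇒ : T (mask p ≡ᵇ 0) → ∀ v → ¬ T (p v)
  empty⇒ eq v = subst T (begin
    p v          ≡⟨ ∈ʷ-mask p v ⟨
    v ∈ʷ mask p  ≡⟨ cong (v ∈ʷ_) (≡ᵇ⇒≡ _ 0 eq) ⟩
    v ∈ʷ 0       ≡⟨ ∈ʷ-∅ v ⟩
    false        ∎)
    where open ≡-Reasoning
  ¬T⇒≡false : ∀ b → ¬ T b → b ≡ false
  ¬T⇒≡false false _  = refl
  ¬T⇒≡false true  ¬t = ⊥-elim (¬t tt)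
  ⇒empty : (∀ v → ¬ T (p v)) → T (mask p ≡ᵇ 0)
  ⇒empty h = ≡⇒≡ᵇ _ 0 (trans (mask-cong λ v → ¬T⇒≡false (p v) (h v)) (mask-∅ n))

module _ {n : ℕ} (test : Fin n → Counted Bool) where
  open WordOps n

  -- Turns the branching of `collect` into one Boolean expression, so that the lemmas below can work
  -- by Boolean algebra.
  ∈ʷ-insertIf : ∀ b u x v →
    v ∈ʷ value (if b then insertʷ u x else return x) ≡ b ∧ does (v Fin.≟ u) ∨ v ∈ʷ x
  ∈ʷ-insertIf true  u x v = ∈ʷ-mask (λ v → does (v Fin.≟ u) ∨ v ∈ʷ x) v
  ∈ʷ-insertIf false u x v = refl

  ∈ʷ-collect-∷ : ∀ u us v → v ∈ʷ value (collect test (u ∷ us)) ≡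
    value (test u) ∧ does (v Fin.≟ u) ∨ v ∈ʷ value (collect test us)
  ∈ʷ-collect-∷ u us v = ∈ʷ-insertIf (value (test u)) u (value (collect test us)) v

  -- Makes no assumption on whether `v` is listed: in `∈ʷ-collect`, a world found at the head may or
  -- may not occur again in the tail.
  ∈ʷ-collect-fail : ∀ us v → value (test v) ≡ false → v ∈ʷ value (collect test us) ≡ false
  ∈ʷ-collect-fail []       v _  = ∈ʷ-∅ v
  ∈ʷ-collect-fail (u ∷ us) v eq = trans (∈ʷ-collect-∷ u us v)
    (cong₂ _∨_ head (∈ʷ-collect-fail us v eq))
    where
    head : value (test u) ∧ does (v Fin.≟ u) ≡ false
    head with v Fin.≟ u
    ... | yes refl = cong (_∧ true) eq
    ... | no  _    = ∧-zeroʳ _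

  ∈ʷ-collect : ∀ {us v} → v ∈ us → v ∈ʷ value (collect test us) ≡ value (test v)
  ∈ʷ-collect {u ∷ us} {v} (here refl) = trans (∈ʷ-collect-∷ v us v) (begin
    value (test v) ∧ does (v Fin.≟ v) ∨ r
      ≡⟨ cong (λ b → value (test v) ∧ b ∨ r) (dec-true (v Fin.≟ v) refl) ⟩
    value (test v) ∧ true ∨ r
      ≡⟨ absorb (value (test v)) refl ⟩
    value (test v) ∎)
    where
    open ≡-Reasoning
    r = v ∈ʷ value (collect test us)
    absorb : ∀ b → value (test v) ≡ b → b ∧ true ∨ r ≡ b
    absorb true  _  = refl
    absorb false eq = ∈ʷ-collect-fail us v eq
  ∈ʷ-collect {u ∷ us} {v} (there v∈us) = trans (∈ʷ-collect-∷ u us v)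
    (trans (cong (value (test u) ∧ does (v Fin.≟ u) ∨_) (∈ʷ-collect v∈us)) absorb)
    where
    -- The list may contain duplicates; if `v` is also the head, its test result is joined with
    -- itself.
    absorb : value (test u) ∧ does (v Fin.≟ u) ∨ value (test v) ≡ value (test v)
    absorb with v Fin.≟ u
    ... | yes refl = trans (cong (_∨ value (test u)) (∧-identityʳ _)) (∨-idem _)
    ... | no  _    = cong (_∨ value (test v)) (∧-zeroʳ (value (test u)))

  collect-reflects : ∀ {P : Set} v → Reflects P (value (test v)) →
    Reflects P (v ∈ʷ value (collect test (allFin n)))
  collect-reflects v = subst (Reflects _) (sym (∈ʷ-collect (∈-allFin v)))

  -- Each listed world costs a tick, its test and at most one insertion, hence `2 + t`; the extra 1
  -- is the initial empty word.
  collect-cost : ∀ {t} → (∀ u → cost (test u) ≤ t) → ∀ us →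
    cost (collect test us) ≤ 1 + length us * (2 + t)
  collect-cost     test≤t []       = ≤-refl
  collect-cost {t} test≤t (u ∷ us) = begin
    1 + (cost (collect test us) + (cost (test u) + cost (insertIf (value (test u)))))
      ≤⟨ +-monoʳ-≤ 1 (+-mono-≤ (collect-cost test≤t us)
           (+-mono-≤ (test≤t u) (insertIf≤1 (value (test u))))) ⟩
    1 + ((1 + length us * (2 + t)) + (t + 1))
      ≡⟨ rearrange (length us * (2 + t)) t ⟩
    1 + ((2 + t) + length us * (2 + t)) ∎
    where
    open ≤-Reasoning
    insertIf : Bool → Counted Word
    insertIf b = if b then insertʷ u (value (collect test us)) else return (value (collect test us))
    insertIf≤1 : ∀ b → cost (insertIf b) ≤ 1
    insertIf≤1 true  = ≤-refl
    insertIf≤1 false = z≤n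
    rearrange : ∀ x t → 1 + ((1 + x) + (t + 1)) ≡ 1 + ((2 + t) + x)
    rearrange = solve-∀

-- Correctness and cost of the checker

module _ (c : Certificate) where
  open Certificate c

  -- Structural induction. Using `Reflects` proves both directions of correctness at once and also
  -- makes satisfaction decidable, which the modal cases need for subformulas.
  truthSet-reflects : ∀ φ v →
    Reflects (recordedModel at v ⊨ φ) (v ∈ʷ value (truthSet succ V φ))
  truthSet-reflects ⊤ᶠ       v = mask-reflects _ v (ofʸ tt)
  truthSet-reflects ⊥ᶠ       v = subst (Reflects _) (sym (∈ʷ-∅ v)) (ofⁿ λ ())
  truthSet-reflects (var i)  v = T-reflects _
  truthSet-reflects (¬ᶠ φ)   v = mask-reflects _ v (¬-reflects (truthSet-reflects φ v))
  truthSet-reflects (φ ∧ᶠ ψ) v =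
    mask-reflects _ v (truthSet-reflects φ v ×-reflects truthSet-reflects ψ v)
  truthSet-reflects (φ ∨ᶠ ψ) v =
    mask-reflects _ v (truthSet-reflects φ v ⊎-reflects truthSet-reflects ψ v)
  -- The complement of the first truth set is itself a mask; reading its bit back gives the form
  -- `not a ∨ b` expected by `_→-reflects_`.
  truthSet-reflects (φ ⇒ᶠ ψ) v = mask-reflects _ v
    (subst (λ b → Reflects (recordedModel at v ⊨ φ ⇒ᶠ ψ) (b ∨ v ∈ʷ value (truthSet succ V ψ)))
      (sym (∈ʷ-mask (λ u → not (u ∈ʷ value (truthSet succ V φ))) v))
      (truthSet-reflects φ v →-reflects truthSet-reflects ψ v))
  truthSet-reflects (□ φ) u =
    collect-reflects _ u (reflects-⇔ (mk⇔ ⇒box box⇒) (mask-empty bad))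
    where
    x̄ = mask {n} λ v → not (v ∈ʷ value (truthSet succ V φ))
    bad : Fin n → Bool
    bad v = v ∈ʷ succ u ∧ v ∈ʷ x̄
    bad-⇔ : ∀ v → T (bad v) ⇔ (T (v ∈ʷ succ u) × ¬ (recordedModel at v ⊨ φ))
    bad-⇔ v = reflects⇒T-⇔
      (T-reflects _ ×-reflects mask-reflects _ v (¬-reflects (truthSet-reflects φ v)))
    ⇒box : (∀ v → ¬ T (bad v)) → recordedModel at u ⊨ □ φ
    -- Emptiness of the bad set only refutes the failure of `φ` at `v`; the induction hypothesis
    -- decides `φ` there and removes the double negation.
    ⇒box none v uRv = decidable-stable (_ because truthSet-reflects φ v) λ ¬φ →
      none v (Equivalence.from (bad-⇔ v) (uRv , ¬φ))
    box⇒ : recordedModel at u ⊨ □ φ → ∀ v → ¬ T (bad v)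
    box⇒ h v b = let uRv , ¬φ = Equivalence.to (bad-⇔ v) b in ¬φ (h v uRv)
  truthSet-reflects (◇ φ) u =
    collect-reflects _ u (reflects-⇔ (mk⇔ ⇒dia dia⇒) (¬-reflects (mask-empty good)))
    where
    good : Fin n → Bool
    good v = v ∈ʷ succ u ∧ v ∈ʷ value (truthSet succ V φ)
    good-⇔ : ∀ v → T (good v) ⇔ (T (v ∈ʷ succ u) × (recordedModel at v ⊨ φ))
    good-⇔ v = reflects⇒T-⇔ (T-reflects _ ×-reflects truthSet-reflects φ v)
    ⇒dia : ¬ (∀ v → ¬ T (good v)) → recordedModel at u ⊨ ◇ φ
    -- A set that is not empty yields an actual successor because there are finitely many worlds and
    -- membership is decidable.
    ⇒dia some with Fin.¬∀⟶∃¬ n _ (λ v → ¬? (T? (good v))) some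
    ... | v , ¬¬good = v , Equivalence.to (good-⇔ v) (decidable-stable (T? (good v)) ¬¬good)
    dia⇒ : recordedModel at u ⊨ ◇ φ → ¬ (∀ v → ¬ T (good v))
    dia⇒ (v , g) none = none v (Equivalence.from (good-⇔ v) g)

  checkK-reflects : Reflects (¬ (recordedModel at w ⊨ formula)) (value (checkK c))
  checkK-reflects = ¬-reflects (truthSet-reflects formula w)

  checkK-correct : class ≡ K → T (value (checkK c)) ⇔ ValidCertificate c
  checkK-correct class≡K = mk⇔
    (λ t → subst (λ 𝒞 → 𝒞 recordedFrame) (sym class≡K) tt , Equivalence.to check⇔ t)
    (Equivalence.from check⇔ ∘ proj₂)
    where check⇔ = reflects⇒T-⇔ checkK-reflects

module _ {n : ℕ} .{{_ : NonZero n}} (succ : Fin n → Word) (V : ℕ → Word) where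
  open ≤-Reasoning

  private
    -- The budget per node, set by the modal clauses: `6 * n` pays for `collect` with tests of cost
    -- at most 4, and `3 * n` absorbs three constant operations, as `n` is nonzero.
    b : ℕ
    b = 9 * n

    2≤b : 2 ≤ b
    2≤b = ≤-trans (m≤m+n 2 7) (m≤m*n 9 n)

    3≤b : 3 ≤ b
    3≤b = ≤-trans (m≤m+n 3 6) (m≤m*n 9 n)

    -- Here `k` counts the operations after both subformulas: one for conjunction and disjunction,
    -- two for implication. The remaining 1 is the tick.
    binary-cost : ∀ {x y p q} k → x ≤ p * b → y ≤ q * b → k + 1 ≤ b →
      1 + (x + (y + k)) ≤ suc (p + q) * b
    binary-cost {x} {y} {p} {q} k x≤ y≤ k≤ = begin
      1 + (x + (y + k))    ≡⟨ rearrange x y k ⟩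
      (k + 1) + (x + y)    ≤⟨ +-mono-≤ k≤ (+-mono-≤ x≤ y≤) ⟩
      b + (p * b + q * b)  ≡⟨ cong (b +_) (*-distribʳ-+ b p q) ⟨
      b + (p + q) * b      ∎
      where
      rearrange : ∀ x y k → 1 + (x + (y + k)) ≡ (k + 1) + (x + y)
      rearrange = solve-∀

    -- The leading 2 is the tick and the complement in the box clause. The diamond clause takes no
    -- complement but has the dearer test, of cost 4.
    collect-test-cost : ∀ {x p} test → (∀ u → cost (test u) ≤ 4) → x ≤ p * b →
      2 + (x + cost (WordOps.collect n test (allFin n))) ≤ suc p * b
    collect-test-cost {x} {p} test test≤4 x≤ = begin
      2 + (x + cost (WordOps.collect n test (allFin n)))
        ≤⟨ +-monoʳ-≤ (2 + x) (collect-cost test test≤4 (allFin n)) ⟩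
      2 + (x + (1 + length (allFin n) * 6))
        ≡⟨ cong (λ l → 2 + (x + (1 + l * 6))) (length-tabulate {n = n} id) ⟩
      2 + (x + (1 + n * 6))
        ≡⟨ rearrange x n ⟩
      (3 + 6 * n) + x
        ≤⟨ +-mono-≤ (+-monoˡ-≤ (6 * n) (m≤m*n 3 n)) x≤ ⟩
      (3 * n + 6 * n) + p * b
        ≡⟨ cong (_+ p * b) (*-distribʳ-+ n 3 6) ⟨
      b + p * b ∎
      where
      rearrange : ∀ x n → 2 + (x + (1 + n * 6)) ≡ (3 + 6 * n) + x
      rearrange = solve-∀

  truthSet-cost : ∀ φ → cost (truthSet succ V φ) ≤ nodes φ * (9 * n)
  truthSet-cost ⊤ᶠ       = m≤n⇒m≤n+o 0 2≤b
  truthSet-cost ⊥ᶠ       = m≤n⇒m≤n+o 0 2≤b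
  truthSet-cost (var i)  = m≤n⇒m≤n+o 0 2≤b
  truthSet-cost (¬ᶠ φ)   = begin
    1 + (cost (truthSet succ V φ) + 1)  ≡⟨ cong suc (+-comm _ 1) ⟩
    2 + cost (truthSet succ V φ)        ≤⟨ +-mono-≤ 2≤b (truthSet-cost φ) ⟩
    b + nodes φ * b                     ∎
  truthSet-cost (φ ∧ᶠ ψ) =
    binary-cost {p = nodes φ} 1 (truthSet-cost φ) (truthSet-cost ψ) 2≤b
  truthSet-cost (φ ∨ᶠ ψ) =
    binary-cost {p = nodes φ} 1 (truthSet-cost φ) (truthSet-cost ψ) 2≤b
  truthSet-cost (φ ⇒ᶠ ψ) =
    binary-cost {p = nodes φ} 2 (truthSet-cost φ) (truthSet-cost ψ) 3≤b
  truthSet-cost (□ φ)    = begin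
    cost (truthSet succ V (□ φ))  ≡⟨ cong suc (+-suc (cost (truthSet succ V φ)) _) ⟩
    _                             ≤⟨ collect-test-cost {p = nodes φ} _ (λ _ → m≤m+n 3 1) (truthSet-cost φ) ⟩
    suc (nodes φ) * b             ∎
  truthSet-cost (◇ φ)    = begin
    cost (truthSet succ V (◇ φ))  ≤⟨ n≤1+n _ ⟩
    _                             ≤⟨ collect-test-cost {p = nodes φ} _ (λ _ → ≤-refl) (truthSet-cost φ) ⟩
    suc (nodes φ) * b             ∎

nodes≢0 : ∀ φ → NonZero (nodes φ)
nodes≢0 ⊤ᶠ       = _
nodes≢0 ⊥ᶠ       = _
nodes≢0 (var _)  = _
nodes≢0 (¬ᶠ _)   = _
nodes≢0 (_ ∧ᶠ _) = _
nodes≢0 (_ ∨ᶠ _) = _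
nodes≢0 (_ ⇒ᶠ _) = _
nodes≢0 (□ _)    = _
nodes≢0 (◇ _)    = _

-- The constant is 9 from `truthSet-cost` plus 2 for the membership test and the negation. The world
-- `w` shows that `n` is nonzero.
checkK-cost : ∀ c → let open Certificate c in cost (checkK c) ≤ 11 * (nodes formula * n)
checkK-cost c = begin
  cost (truthSet succ V formula) + 2  ≤⟨ +-mono-≤ (truthSet-cost succ V formula) (m≤m*n 2 s) ⟩
  nodes formula * (9 * n) + 2 * s     ≡⟨ rearrange (nodes formula) n ⟩
  11 * s                              ∎
  where
  open Certificate c
  open ≤-Reasoning
  s = nodes formula * n
  instance
    n≢0 : NonZero n
    n≢0 = Fin.nonZeroIndex w
    s≢0 : NonZero s
    s≢0 = m*n≢0 (nodes formula) n {{nodes≢0 formula}}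
  rearrange : ∀ m n → m * (9 * n) + 2 * (m * n) ≡ 11 * (m * n)
  rearrange = solve-∀

-- Invariance under isomorphism, and decidability

-- A strict bound: every variable of the formula has a smaller index.
varBound : Formula → ℕ
varBound ⊤ᶠ       = 0
varBound ⊥ᶠ       = 0
varBound (var i)  = suc i
varBound (¬ᶠ φ)   = varBound φ
varBound (φ ∧ᶠ ψ) = varBound φ ⊔ varBound ψ
varBound (φ ∨ᶠ ψ) = varBound φ ⊔ varBound ψ
varBound (φ ⇒ᶠ ψ) = varBound φ ⊔ varBound ψ
varBound (□ φ)    = varBound φ
varBound (◇ φ)    = varBound φ

T-cong : ∀ {a b} → a ≡ b → T a ⇔ T b
T-cong refl = ⇔-id _

module _ (M N : Model) (f : Model.World M ↔ Model.World N) where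
  private
    module M = Model M
    module N = Model N
  open Inverse f

  module _ (R-preserved : ∀ u v → M.R u v ≡ N.R (to u) (to v)) where

    -- Lets a successor in `N` be pulled back to a successor in `M`, as the modal cases of `⊨-iso`
    -- require.
    R-from : ∀ w v′ → M.R w (from v′) ≡ N.R (to w) v′
    R-from w v′ = trans (R-preserved w (from v′)) (cong (N.R (to w)) (strictlyInverseˡ v′))

    -- Agreement of the valuations is asked only below `varBound φ`. This one lemma thus covers both
    -- the renaming of worlds and, along the identity, a change of valuation outside the variables
    -- of `φ`.
    ⊨-iso : ∀ φ → (∀ i → i < varBound φ → ∀ u → M.V i u ≡ N.V i (to u)) →
      ∀ w → (M at w ⊨ φ) ⇔ (N at to w ⊨ φ)
    ⊨-iso ⊤ᶠ       V≡ w = ⇔-id _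
    ⊨-iso ⊥ᶠ       V≡ w = ⇔-id _
    ⊨-iso (var i)  V≡ w = T-cong (V≡ i ≤-refl w)
    ⊨-iso (¬ᶠ φ)   V≡ w = ¬-cong-⇔ (⊨-iso φ V≡ w)
    ⊨-iso (φ ∧ᶠ ψ) V≡ w =
      ⊨-iso φ (λ i → V≡ i ∘ m<n⇒m<n⊔o _) w ×-⇔ ⊨-iso ψ (λ i → V≡ i ∘ m<n⇒m<o⊔n _) w
    ⊨-iso (φ ∨ᶠ ψ) V≡ w =
      ⊨-iso φ (λ i → V≡ i ∘ m<n⇒m<n⊔o _) w ⊎-⇔ ⊨-iso ψ (λ i → V≡ i ∘ m<n⇒m<o⊔n _) w
    ⊨-iso (φ ⇒ᶠ ψ) V≡ w = →-cong-⇔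
      (⊨-iso φ (λ i → V≡ i ∘ m<n⇒m<n⊔o _) w) (⊨-iso ψ (λ i → V≡ i ∘ m<n⇒m<o⊔n _) w)
    ⊨-iso (□ φ)    V≡ w = mk⇔
      (λ h v′ r → subst (N at_⊨ φ) (strictlyInverseˡ v′)
        (Equivalence.to (⊨-iso φ V≡ (from v′))
          (h (from v′) (subst T (sym (R-from w v′)) r))))
      (λ h v r → Equivalence.from (⊨-iso φ V≡ v) (h (to v) (subst T (R-preserved w v) r)))
    ⊨-iso (◇ φ)    V≡ w = mk⇔
      (λ (v , r , h) → to v , subst T (R-preserved w v) r , Equivalence.to (⊨-iso φ V≡ v) h)
      (λ (v′ , r , h) → from v′ , subst T (sym (R-from w v′)) r ,
        Equivalence.from (⊨-iso φ V≡ (from v′)) (subst (N at_⊨ φ) (sym (strictlyInverseˡ v′)) h))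

certify : (M : Model) → Model.World M → Formula → Certificate
certify M w φ = record
  { formula   = φ
  ; n         = size
  ; succ      = λ u → mask λ v → R (from u) (from v)
  ; succ-mask = λ u → mask-isMask (λ v → R (from u) (from v))
  ; V         = λ i → mask λ v → V i (from v)
  ; V-mask    = λ i → mask-isMask (V i ∘ from)
  ; w         = to w
  ; class     = K
  }
  where
  open Model M
  open Inverse enum

certify-records : ∀ M w φ → Records (certify M w φ) M w
certify-records M w φ = record
  { relabel       = Model.enum M
  ; succ-records  = λ _ → refl
  ; V-records     = λ _ → refl
  ; world-records = refl
  }

certify-⊨ : ∀ M w φ → let open Certificate (certify M w φ) renaming (w to w′) in
  (M at w ⊨ φ) ⇔ (recordedModel at w′ ⊨ φ)
certify-⊨ M w φ = ⊨-iso M (Certificate.recordedModel (certify M w φ)) enum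
  (λ u v → sym (trans (∈ʷ-mask _ (to v)) (cong₂ R (strictlyInverseʳ u) (strictlyInverseʳ v))))
  φ (λ i _ u → sym (trans (∈ʷ-mask _ (to u)) (cong (V i) (strictlyInverseʳ u))))
  w
  where
  open Model M
  open Inverse enum

-- `certify` records any model, whether or not the formula is false there, so `truthSet` can be run
-- on the recorded copy and its answer carried back.
sat? : ∀ M w φ → Dec (M at w ⊨ φ)
sat? M w φ = map′ (Equivalence.from iso) (Equivalence.to iso)
  (_ because truthSet-reflects (certify M w φ) φ _)
  where iso = certify-⊨ M w φ

module _ (F : Frame) where
  open Frame F
  open Inverse enum

  anyWorld? : ∀ {P : World → Set} → Decidable P → Dec (∃ P)
  anyWorld? {P} P? = map′ (Product.map from id)
    (λ (w , p) → to w , subst P (sym (strictlyInverseʳ w)) p) (Fin.any? (P? ∘ from))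

  -- A valuation of the variables below N is encoded as a subset of N × W.
  module _ (N : ℕ) where

    decode : Subset (N * size) → Valuation F
    decode s i w with i <? N
    ... | yes i<N = Vec.lookup s (combine (fromℕ< i<N) (to w))
    -- An arbitrary default: with `N = varBound φ` these variables do not occur in `φ`.
    ... | no  _   = false

    encode : Valuation F → Subset (N * size)
    encode V = Vec.tabulate λ j → let i , x = remQuot {N} size j in V (toℕ i) (from x)

    decode-encode : ∀ V i → i < N → ∀ w → decode (encode V) i w ≡ V i w
    decode-encode V i i<N w with i <? N
    ... | no  i≮N = contradiction i<N i≮N
    ... | yes i<N = begin
      Vec.lookup (encode V) (combine (fromℕ< i<N) (to w))
        ≡⟨ Vec.lookup∘tabulate _ (combine (fromℕ< i<N) (to w)) ⟩
      uncurry (λ i x → V (toℕ i) (from x)) (remQuot {N} size (combine (fromℕ< i<N) (to w)))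
        ≡⟨ cong (uncurry λ i x → V (toℕ i) (from x)) (Fin.remQuot-combine (fromℕ< i<N) (to w)) ⟩
      V (toℕ (fromℕ< i<N)) (from (to w))
        ≡⟨ cong₂ V (Fin.toℕ-fromℕ< i<N) (strictlyInverseʳ w) ⟩
      V i w ∎
      where open ≡-Reasoning

  falsifiable? : ∀ φ → Dec (∃[ V ] ∃[ w ] ¬ (⟨ F , V ⟩ at w ⊨ φ))
  falsifiable? φ = map′ (Product.map (decode N) id)
    -- A falsifying valuation still falsifies after encoding and decoding, since it keeps its values
    -- on the variables of `φ`; hence searching the subsets misses nothing.
    (λ (V , w , ¬φ) → encode N V , w , ¬φ ∘ Equivalence.to (recode V w))
    (anySubset? λ s → anyWorld? λ w → ¬? (sat? ⟨ F , decode N s ⟩ w φ))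
    where
    N = varBound φ
    recode : ∀ V w → (⟨ F , decode N (encode N V) ⟩ at w ⊨ φ) ⇔ (⟨ F , V ⟩ at w ⊨ φ)
    recode V = ⊨-iso _ _ (↔-id _) (λ _ _ → refl) φ (decode-encode N V)

  ⊭⇒falsifiable : ∀ φ → ¬ (F ⊨ᶠ φ) → ∃[ V ] ∃[ w ] ¬ (⟨ F , V ⟩ at w ⊨ φ)
  ⊭⇒falsifiable φ F⊭φ = decidable-stable (falsifiable? φ) λ none →
    F⊭φ λ V w → decidable-stable (sat? _ w φ) λ ¬φ → none (V , w , ¬φ)

-- Indistinguishability, minimal countermodels and disagreement

indistinguishable-⇔ : ∀ φ ψ k →
  Indistinguishable k φ ψ ⇔ MinimalCountermodelSize K (φ ⇔ᶠ ψ) (suc k)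
indistinguishable-⇔ φ ψ k = mk⇔ ⇒minimal minimal⇒
  where
  χ = φ ⇔ᶠ ψ
  open Countermodel
  ⇒minimal : Indistinguishable k φ ψ → MinimalCountermodelSize K χ (suc k)
  ⇒minimal (small , F , size≡ , F⊭χ) with ⊭⇒falsifiable F χ F⊭χ
  ... | V , w , ¬χ =
    (record { model = ⟨ F , V ⟩ ; world = w ; inClass = tt ; falsified = ¬χ } , size≡) ,
    -- A countermodel with at most `k` worlds would contradict validity on small frames, and size
    -- not at most `k` means size at least `suc k`.
    λ c → ≰⇒> λ size≤k → falsified c (small _ size≤k _ (world c))
  minimal⇒ : MinimalCountermodelSize K χ (suc k) → Indistinguishable k φ ψ
  minimal⇒ ((c , size≡) , minimal) =
    -- If `χ` failed at `w`, this would be a countermodel below the minimal size; decidability of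
    -- satisfaction turns the refutation into truth.
    (λ F size≤k V w → decidable-stable (sat? ⟨ F , V ⟩ w χ) λ ¬χ →
      <⇒≱ (minimal record { model = ⟨ F , V ⟩ ; world = w ; inClass = tt ; falsified = ¬χ }) size≤k) ,
    _ , size≡ , λ F⊨χ → falsified c (F⊨χ _ (world c))

-- Deciding both formulas at `w` leaves four cases; equal truth values would make both implications
-- true.
falsified⇒disagree : ∀ M w φ ψ → ¬ (M at w ⊨ φ ⇔ᶠ ψ) → Disagree M w φ ψ
falsified⇒disagree M w φ ψ ¬χ with sat? M w φ | sat? M w ψ
... | yes p | yes q = contradiction (const q , const p) ¬χ
... | yes p | no ¬q = inj₁ (p , ¬q)
... | no ¬p | yes q = inj₂ (¬p , q)
... | no ¬p | no ¬q = contradiction ((λ p → contradiction p ¬p) , (λ q → contradiction q ¬q)) ¬χ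

proposition4 : ((c : Certificate) → Certificate.class c ≡ K →
    T (value (checkK c)) ⇔ ValidCertificate c) ×
    (∃[ C ] ((φ ψ : Formula) (k : ℕ) → let χ = φ ⇔ᶠ ψ in
    (Indistinguishable k φ ψ ⇔ MinimalCountermodelSize K χ (suc k)) ×
    (Indistinguishable k φ ψ →
    (M : Model) (w : Model.World M) →
    Model.size M ≡ suc k → ¬ (M at w ⊨ χ) →
    (K (Model.frame M) × ¬ (Model.frame M ⊨ᶠ χ) × ¬ ValidOn K χ) ×
    (Σ[ c ∈ Certificate ]
    Certificate.formula c ≡ χ ×
    Certificate.n c ≡ suc k ×
    Certificate.class c ≡ K ×
    Records c M w ×
    ValidCertificate c ×
    cost (checkK c) ≤ C * (nodes χ * suc k)) ×
    Disagree M w φ ψ)))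
proposition4 = checkK-correct , 11 , λ φ ψ k → indistinguishable-⇔ φ ψ k ,
  λ _ M w size≡ ¬χ → let χ = φ ⇔ᶠ ψ; c = certify M w χ in
    (tt , (λ F⊨χ → ¬χ (F⊨χ _ w)) , (λ valid → ¬χ (valid (Model.frame M) tt _ w))) ,
    (c , refl , size≡ , refl , certify-records M w χ ,
      (tt , ¬χ ∘ Equivalence.from (certify-⊨ M w χ)) ,
      -- `checkK-cost` bounds the cost by the number of worlds of `M`, which `size≡` identifies with
      -- `suc k`.
      subst (λ m → cost (checkK c) ≤ 11 * (nodes χ * m)) size≡ (checkK-cost c)) ,
    falsified⇒disagree M w φ ψ ¬χ
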